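{- There exist an integer $m$ and a sequence of adversarial injections, consisting of $m$ initializing and $m$ non-initializing packets for $m$ buffers of size $B=1$, such that the optimal offline algorithm can accommodate all the non-initializing packets and, for the algorithm RANDOM PERMUTATION run on this sequence, $$\sum_{i=1}^{m} p_i<\sum_{i=1}^{m} v_i ,\qquad\text{where}\qquad v_i=\frac{1}{m!}\sum_{j=1}^{i}\binom{i}{j}\,(m-j)!\,(-1)^{j-1}$$ and $p_i$ is the probability that RANDOM PERMUTATION accepts the $i$-th non-initializing packet.
   Context: Setting: there are $m$ buffers, each of capacity $B=1$ packet, initially empty. At each integer time $t\ge 0$ the adversary may inject any number of packets into any buffers; packets not fitting into a buffer are lost (not accepted). Then in the step $(t,t+1)$ an algorithm may transmit a single packet from one non-empty buffer. The injection sequence is fixed in advance and does not depend on the random choices of the algorithm (oblivious adversary). RANDOM PERMUTATION: at the beginning it chooses a permutation of the $m$ buffers uniformly at random; in every step it transmits a packet from the non-empty buffer that is most to the front in the permutation (if there is any non-empty buffer). The first packet injected into a particular buffer is called initializing and all subsequent packets injected into this buffer are called non-initializing. Non-initializing packets are numbered $1,2,\dots$ in the order of their arrival (packets injected at the same time are numbered in arbitrary order). The optimal offline algorithm knows the whole injection sequence in advance; it can accommodate a set of packets if some schedule of transmissions loses none of them. -}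

module Defs where

open import Data.Bool.Base using (Bool; true; if_then_else_; not)
open import Data.Bool.Properties using () renaming (_≟_ to _≟ᵇ_)
open import Data.Fin.Base using (Fin; zero; suc; punchIn)
open import Data.Fin.Permutation
  using (Permutation′; _⟨$⟩ʳ_; _≈_; id; insert; remove; insert-remove)
open import Data.Fin.Subset using (Subset; ⊥; ⁅_⁆; _∪_; _-_)
open import Data.Fin.Subset.Properties using (_∈?_)
open import Data.Integer.Base as ℤ using (ℤ; +_; -1ℤ; 0ℤ)
open import Data.List.Base
  using (List; []; _∷_; _++_; length; map; foldl; foldr; find; filter; head; drop;
         concat; allFin; applyUpTo; cartesianProductWith)
open import Data.List.Membership.Propositional using (_∈_)
open import Data.List.Membership.Propositional.Properties
  using (∈-cartesianProductWith⁺; ∈-allFin)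
open import Data.List.Properties using (length-++; length-map; length-tabulate)
open import Data.List.Relation.Unary.All using (All)
open import Data.List.Relation.Unary.Any using (here)
open import Data.Maybe.Base using (Maybe; just; nothing)
open import Data.Maybe.Properties using (≡-dec)
open import Data.Nat.Base using (ℕ; zero; suc; _!; _∸_; _+_; _*_)
open import Data.Nat.Combinatorics using (_C_)
open import Data.Nat.Properties using (_!≢0)
open import Data.Product.Base using (Σ-syntax; ∃-syntax; _×_; _,_; proj₁; proj₂)
open import Data.Rational.Base as ℚ using (ℚ; 0ℚ)
open import Function.Base using (_∘_)
import Function.Base as F
open import Level using (Level)
open import Relation.Binary.PropositionalEquality
  using (_≡_; refl; trans; cong; cong₂)
open import Relation.Nullary.Decidable.Core using (does)
open import Relation.Unary using (Pred; Decidable)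

private
  variable
    a ℓ : Level
    A : Set a
    m : ℕ

-- The t-th entry lists the target buffers of the packets injected at time t.
-- The order inside an entry is the (arbitrary) order in which simultaneous
-- packets are numbered.  Nothing is injected after the end of the list.
Injections : ℕ → Set
Injections m = List (List (Fin m))

-- As buffers have capacity 1, the configuration is the set of full buffers.
Config : ℕ → Set
Config = Subset

-- The buffer to transmit from in the step (t , t+1), given t and the
-- configuration after the injections of time t.
Algorithm : ℕ → Set
Algorithm m = ℕ → Config m → Maybe (Fin m)

-- Selecting an empty buffer has the same effect as transmitting nothing.
transmit : Maybe (Fin m) → Config m → Config m
transmit nothing  S = S
transmit (just b) S = S - b

fill : Config m → List (Fin m) → Config m
fill = foldl (λ S b → S ∪ ⁅ b ⁆)

-- Packets in order of arrival, each with its buffer and whether it was accepted.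
Log : ℕ → Set
Log m = List (Fin m × Bool)

receive : Config m → List (Fin m) → Log m
receive S []       = []
receive S (b ∷ bs) = (b , not (does (b ∈? S))) ∷ receive (S ∪ ⁅ b ⁆) bs

runFrom : Algorithm m → ℕ → Config m → Injections m → Log m
runFrom alg t S []       = []
runFrom alg t S (bs ∷ I) =
  receive S bs ++ runFrom alg (suc t) (transmit (alg t S′) S′) I
  where S′ = fill S bs

run : Algorithm m → Injections m → Log m
run alg = runFrom alg 0 ⊥

-- The set `seen` holds the buffers into which a packet has been injected.
initializingFrom : Subset m → (A → Fin m) → List A → List A
initializingFrom seen buf []       = []
initializingFrom seen buf (x ∷ xs) =
  if does (buf x ∈? seen)
  then initializingFrom seen buf xs
  else x ∷ initializingFrom (seen ∪ ⁅ buf x ⁆) buf xs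

nonInitializingFrom : Subset m → (A → Fin m) → List A → List A
nonInitializingFrom seen buf []       = []
nonInitializingFrom seen buf (x ∷ xs) =
  if does (buf x ∈? seen)
  then x ∷ nonInitializingFrom seen buf xs
  else nonInitializingFrom (seen ∪ ⁅ buf x ⁆) buf xs

initializing nonInitializing : (A → Fin m) → List A → List A
initializing    = initializingFrom ⊥
nonInitializing = nonInitializingFrom ⊥

#initializing #nonInitializing : Injections m → ℕ
#initializing    I = length (initializing    F.id (concat I))
#nonInitializing I = length (nonInitializing F.id (concat I))

nonInitAccepted : Algorithm m → Injections m → List Bool
nonInitAccepted alg I = map proj₂ (nonInitializing proj₁ (run alg I))

-- The schedule is chosen for the given injection sequence.  Packets are still
-- accepted greedily: only transmissions are scheduled.
OfflineAccommodatesNonInit : Injections m → Set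
OfflineAccommodatesNonInit {m} I =
  Σ[ schedule ∈ (ℕ → Maybe (Fin m)) ]
    All (_≡ true) (nonInitAccepted (λ t _ → schedule t) I)

permutations : ∀ m → List (Permutation′ m)
permutations zero    = id ∷ []
permutations (suc m) =
  cartesianProductWith (insert zero) (allFin (suc m)) (permutations m)

-- Every permutation is listed, up to pointwise equality; as there are m !
-- entries, each occurs exactly once.
length-permutations : ∀ m → length (permutations m) ≡ m !
length-permutations zero    = refl
length-permutations (suc m) = trans
  (lengths (allFin (suc m)))
  (cong₂ _*_ (length-tabulate {n = suc m} F.id) (length-permutations m))
  where
  πs : List (Permutation′ m)
  πs = permutations m

  lengths : (js : List (Fin (suc m))) →
            length (cartesianProductWith (insert zero) js πs) ≡ length js * length πs
  lengths []       = refl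
  lengths (j ∷ js) = trans
    (length-++ (map (insert zero j) πs))
    (cong₂ _+_ (length-map (insert zero j) πs) (lengths js))

permutations-complete : (π : Permutation′ m) → ∃[ ρ ] ρ ∈ permutations m × ρ ≈ π
permutations-complete {zero}  π = id , here refl , λ ()
permutations-complete {suc m} π with permutations-complete (remove zero π)
... | ρ , ρ∈ , ρ≈ =
  insert zero j ρ ,
  ∈-cartesianProductWith⁺ (insert zero) (∈-allFin j) ρ∈ ,
  λ i → trans (insert-cong i) (insert-remove zero π i)
  where
  j : Fin (suc m)
  j = π ⟨$⟩ʳ zero

  insert-cong : insert zero j ρ ≈ insert zero j (remove zero π)
  insert-cong zero    = refl
  insert-cong (suc i) = cong (punchIn j) (ρ≈ i)

Pr : {E : Pred (Permutation′ m) ℓ} → Decidable E → ℚ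
Pr {m} E? = + length (filter E? (permutations m)) ℚ./ m !
  where instance _ = m !≢0

-- The permutation maps positions (position zero being the front) to buffers.
randomPermutation : Permutation′ m → Algorithm m
randomPermutation {m} π _ S = find (_∈? S) (map (π ⟨$⟩ʳ_) (allFin m))

-- The index i is counted from 1.
AcceptsNonInit : Algorithm m → Injections m → ℕ → Set
AcceptsNonInit alg I i = head (drop (i ∸ 1) (nonInitAccepted alg I)) ≡ just true

p : Injections m → ℕ → ℚ
p {m} I i =
  Pr {E = λ π → AcceptsNonInit (randomPermutation {m} π) I i}
     (λ π → ≡-dec _≟ᵇ_ _ _)

sum[1…_]ℤ : ℕ → (ℕ → ℤ) → ℤ
sum[1… n ]ℤ f = foldr ℤ._+_ 0ℤ (applyUpTo (f ∘ suc) n)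

sum[1…_]ℚ : ℕ → (ℕ → ℚ) → ℚ
sum[1… n ]ℚ f = foldr ℚ._+_ 0ℚ (applyUpTo (f ∘ suc) n)

v : ℕ → ℕ → ℚ
v m i =
  sum[1… i ]ℤ (λ j → + (i C j) ℤ.* + ((m ∸ j) !) ℤ.* (-1ℤ ℤ.^ (j ∸ 1))) ℚ./ m !
  where instance _ = m !≢0

{-# OPTIONS --safe #-}
-- In this sequence buffer 3 receives its initializing packet only at time 2,
-- simultaneously with a non-initializing packet, and buffer 0 receives two
-- non-initializing packets.  Summed over all 24 permutations, RANDOM PERMUTATION
-- accepts 43 non-initializing packets, whereas 24 (v₁ + v₂ + v₃ + v₄) =
-- 6 + 10 + 13 + 15 = 44.
module Submission where

open import Defs
open import Data.Fin.Base using (Fin)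
open import Data.Fin.Patterns using (0F; 1F; 2F; 3F)
open import Data.List.Base using ([]; _∷_; [_])
open import Data.List.Relation.Unary.All using ([]; _∷_)
open import Data.Maybe.Base using (Maybe; just; nothing)
open import Data.Nat.Base using (ℕ)
open import Data.Product.Base using (Σ-syntax; _×_; _,_)
open import Data.Rational.Base using (_<_)
open import Data.Rational.Properties using (_<?_)
open import Relation.Binary.PropositionalEquality using (_≡_; refl)
open import Relation.Nullary.Decidable using (toWitness)

injections : Injections 4
injections = (0F ∷ 1F ∷ 2F ∷ []) ∷ [ 2F ] ∷ (0F ∷ 3F ∷ []) ∷ [ 0F ] ∷ [ 3F ] ∷ []

-- The non-initializing packets go to buffers 2, 0, 0, 3 at times 1 to 4, so each step empties the
-- buffer that the next of them enters. Nothing arrives after time 4.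
schedule : ℕ → Maybe (Fin 4)
schedule 0 = just 2F
schedule 1 = just 0F
schedule 2 = just 0F
schedule 3 = just 3F
schedule _ = nothing

Σp<Σv : sum[1… 4 ]ℚ (p injections) < sum[1… 4 ]ℚ (v 4)
-- Both sums are closed, so the decision evaluates, running all 24 permutations; `_` then has unit
-- type and is filled by eta.
Σp<Σv = toWitness {a? = sum[1… 4 ]ℚ (p injections) <? sum[1… 4 ]ℚ (v 4)} _

lemma16 : Σ[ m ∈ ℕ ] Σ[ I ∈ Injections m ]
    (#initializing I ≡ m) ×
    (#nonInitializing I ≡ m) ×
    OfflineAccommodatesNonInit I ×
    (sum[1… m ]ℚ (p I) < sum[1… m ]ℚ (v m))
lemma16 =
  4 , injections , refl , refl ,
  -- One `refl` per non-initializing packet: running `schedule` computes each acceptance flag to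
  -- `true`.
  (schedule , refl ∷ refl ∷ refl ∷ refl ∷ []) , Σp<Σv
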